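{- Let $k\ge 2$ be an integer and let $F$ be a graph with chromatic number $\chi(F)=k+1$. For every $\varepsilon>0$ there exists $n_0$ such that every $F$-free graph $G$ on $n\ge n_0$ vertices with $m$ edges satisfies \[ \sum_{v\in V(G)} d^2(v)\le 2\left(1-\frac{1}{k}+\varepsilon\right)mn. \] Moreover, $\sum_{v} d^2(v)=2(1-\frac1k)mn$ holds when $k=2$ and $G$ is a complete bipartite graph, and when $k\ge3$ and $G=T_{n,k}$ with $k$ dividing $n$.
   Context: All graphs are finite and simple; $d(v)$ is the degree of vertex $v$. A graph is $F$-free if it contains no subgraph isomorphic to $F$. $T_{n,k}$ is the complete $k$-partite graph on $n$ vertices with part sizes differing by at most one. -}

module Defs where

open import Algebra.Properties.Semiring.Sum using (sum)
open import Data.Bool using (_∧_)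
open import Data.Fin using (Fin; _<?_; _≟_)
open import Data.Fin.Subset using (Subset; ∣_∣)
open import Data.Integer using (+_)
open import Data.Nat using (ℕ; _+_; _^_; _≤_)
open import Data.Nat.Properties using (+-*-semiring)
open import Data.Product using (Σ; Σ-syntax; _×_)
open import Data.Rational using (ℚ; _/_)
open import Data.Vec using (tabulate)
open import Function.Bundles using (_⇔_)
open import Function.Definitions using (Injective)
open import Level using (0ℓ)
open import Relation.Binary using (Rel; Decidable; Symmetric; Irreflexive)
open import Relation.Binary.PropositionalEquality using (_≡_; _≢_)
open import Relation.Nullary using (¬_; does)

-- Finite simple graphs on the vertex set Fin n.
record Graph (n : ℕ) : Set₁ where
  infix 4 _~_ _~?_
  field
    _~_      : Rel (Fin n) 0ℓ
    _~?_     : Decidable _~_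
    ~-sym    : Symmetric _~_
    ~-irrefl : Irreflexive _≡_ _~_

  N : Fin n → Subset n
  N v = tabulate λ u → does (v ~? u)

  degree : Fin n → ℕ
  degree v = ∣ N v ∣

  -- Each edge is counted once, at its smaller endpoint.
  edgeCount : ℕ
  edgeCount = sum +-*-semiring λ u →
    ∣ tabulate (λ v → does (u <? v) ∧ does (u ~? v)) ∣

  degreeSquareSum : ℕ
  degreeSquareSum = sum +-*-semiring λ v → degree v ^ 2

open Graph public using (degree; edgeCount; degreeSquareSum)

-- A subgraph of G isomorphic to F, given by the isomorphism from F onto it.
-- The subgraph need not be induced, so non-edges of F are unconstrained.
record Copy {f n : ℕ} (F : Graph f) (G : Graph n) : Set where
  private
    module F = Graph F
    module G = Graph G
  field
    embed     : Fin f → Fin n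
    injective : Injective _≡_ _≡_ embed
    edges     : ∀ {u v} → u F.~ v → embed u G.~ embed v

_-Free_ : {f n : ℕ} → Graph f → Graph n → Set
F -Free G = ¬ Copy F G

Colorable : {n : ℕ} → Graph n → ℕ → Set
Colorable {n} G c = Σ[ col ∈ (Fin n → Fin c) ] (∀ {u v} → u ~ v → col u ≢ col v)
  where open Graph G

HasChromaticNumber : {n : ℕ} → Graph n → ℕ → Set
HasChromaticNumber G c = Colorable G c × (∀ {c′} → Colorable G c′ → c ≤ c′)

-- G is complete k-partite with classes the fibres of `part`.
IsCompletePartition : {n k : ℕ} → Graph n → (Fin n → Fin k) → Set
IsCompletePartition G part = ∀ u v → (u ~ v) ⇔ (part u ≢ part v)
  where open Graph G

partSize : {n k : ℕ} → (Fin n → Fin k) → Fin k → ℕ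
partSize part i = ∣ tabulate (λ v → does (part v ≟ i)) ∣

IsCompleteBipartite : {n : ℕ} → Graph n → Set
IsCompleteBipartite {n} G = Σ (Fin n → Fin 2) (IsCompletePartition G)

-- G is T_{n,k}, up to isomorphism.
IsTurán : {n : ℕ} → Graph n → ℕ → Set
IsTurán {n} G k = Σ[ part ∈ (Fin n → Fin k) ]
  IsCompletePartition G part × (∀ i j → partSize part i ≤ partSize part j + 1)

fromℕ : ℕ → ℚ
fromℕ n = + n / 1

{-# OPTIONS --safe #-}
-- Let N_s be the number of ordered s-cliques and d(C) the number of common neighbours of a clique C.
-- Counting the vertices joined to all but at most one vertex of an (s+1)-clique gives
--   (s + 1) Σ_C d(C)² ≤ n N_{s+1} + s N_{s+2}    (C over the ordered s-cliques).
-- For s = 1 the left side is 2 Σ_v d(v)², so a violation of the bound makes N_3 / (n N_2) large; by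
-- Cauchy–Schwarz and the same inequality for larger s, N_{s+1} ≥ c n N_s for all 2 ≤ s ≤ k. As also
-- N_3 ≤ N_2^{3/2}, the case s = 2 forces N_2 ≥ c² n², so sparse graphs need no separate treatment.
-- Hence N_{k+1} ≥ c' n^{k+1}, and Erdős's theorem on dense hypergraphs yields a complete
-- (k+1)-partite subgraph with classes of size |F|, which contains F.
module Submission where

open import Defs

-- Why the threshold is 1 - 1/k. Let r_s be a constant with Σ_C d(C)² ≥ r_s n N_{s+1}, where C runs
-- over the s-cliques. The counting inequality then gives N_{s+2} ≥ r n N_{s+1} with s r = (s + 1)
-- r_s - 1, and Cauchy-Schwarz makes r admissible as r_{s+1}. If r_s = 1 - s x, then r_{s+1} = 1 -
-- (s + 1) x, so every step costs the same x. A violated bound means r_1 = 1 - x with x < 1/k, hence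
-- 1 - k x, the ratio reached at the (k+1)-cliques, is still positive. The number ε enters only
-- through 1/(k + e), with e its denominator. Adding k keeps x = 1/k - 1/(k + e) = e / (k (k + e))
-- positive even if ε is large, and multiplying by k (k + e) moves all of the clique counting into
-- ℕ.

module _ where
  open import Data.Bool using (Bool; true; false; _∧_; if_then_else_)
  open import Data.Fin as Fin using (Fin; zero; suc)
  import Data.Fin.Properties as Finₚ
  open import Data.Fin.Subset using (∣_∣)
  open import Data.Nat
  open import Data.Nat.Divisibility using (_∣_; divides)
  open import Data.Nat.Properties
  open import Data.Nat.Tactic.RingSolver using (solve-∀)
  open import Algebra.Properties.Semiring.Sum +-*-semiring
  open import Data.Product using (_×_; _,_; ∃-syntax; Σ-syntax; map₂)
  open import Data.Sum using (inj₁; inj₂)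
  open import Data.Vec using (Vec; []; _∷_; insertAt; removeAt; tabulate)
  open import Data.Vec.Properties using (removeAt-insertAt)
  open import Function.Base using (_∘_)
  open import Function.Bundles using (module Equivalence)
  open import Function.Definitions using (Injective)
  open import Relation.Binary.Definitions using (tri<; tri≈; tri>)
  open import Relation.Binary.PropositionalEquality
  open import Relation.Nullary using (Dec; ¬_; yes; no; does; contradiction)
  open import Relation.Nullary.Decidable using (dec-true; dec-false)

  -- Sums over vertices and over tuples of vertices

  sum-mono : ∀ {n} {f g : Fin n → ℕ} → (∀ i → f i ≤ g i) → sum f ≤ sum g
  sum-mono {zero}  f≤g = z≤n
  sum-mono {suc n} f≤g = +-mono-≤ (f≤g zero) (sum-mono (f≤g ∘ suc))

  sum-const : ∀ n c → sum {n} (λ _ → c) ≡ n * c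
  sum-const zero    c = refl
  sum-const (suc n) c = cong (c +_) (sum-const n c)

  term≤sum : ∀ {n} (f : Fin n → ℕ) i → f i ≤ sum f
  term≤sum f zero    = m≤m+n (f zero) _
  term≤sum f (suc i) = ≤-trans (term≤sum (f ∘ suc) i) (m≤n+m _ (f zero))

  sum-<-witness : ∀ {n} {f g : Fin n → ℕ} → sum f < sum g → ∃[ i ] f i < g i
  sum-<-witness {suc n} {f} {g} lt with f zero <? g zero
  ... | yes f₀<g₀ = zero , f₀<g₀
  ... | no  f₀≮g₀ =
    let i , fi<gi = sum-<-witness (+-cancelˡ-< (f zero) _ _
                      (<-≤-trans lt (+-monoˡ-≤ _ (≮⇒≥ f₀≮g₀))))
    in suc i , fi<gi

  vsum : ∀ {r n} → (Vec (Fin n) r → ℕ) → ℕ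
  vsum {zero}  f = f []
  vsum {suc r} f = sum λ v → vsum λ y → f (v ∷ y)

  vsum-cong : ∀ {r n} {f g : Vec (Fin n) r → ℕ} → (∀ y → f y ≡ g y) → vsum f ≡ vsum g
  vsum-cong {zero}  f≡g = f≡g []
  vsum-cong {suc r} f≡g = sum-cong-≗ λ v → vsum-cong λ y → f≡g (v ∷ y)

  vsum-mono : ∀ {r n} {f g : Vec (Fin n) r → ℕ} → (∀ y → f y ≤ g y) → vsum f ≤ vsum g
  vsum-mono {zero}  f≤g = f≤g []
  vsum-mono {suc r} f≤g = sum-mono λ v → vsum-mono λ y → f≤g (v ∷ y)

  vsum-const : ∀ r n c → vsum {r} {n} (λ _ → c) ≡ n ^ r * c
  vsum-const zero    n c = sym (+-identityʳ c)
  vsum-const (suc r) n c = begin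
    sum {n} (λ _ → vsum {r} {n} (λ _ → c)) ≡⟨ sum-cong-≗ {n} (λ _ → vsum-const r n c) ⟩
    sum {n} (λ _ → n ^ r * c)              ≡⟨ sum-const n _ ⟩
    n * (n ^ r * c)                        ≡⟨ *-assoc n (n ^ r) c ⟨
    n ^ suc r * c                          ∎
    where open ≡-Reasoning

  vsum-+ : ∀ {r n} (f g : Vec (Fin n) r → ℕ) → vsum (λ y → f y + g y) ≡ vsum f + vsum g
  vsum-+ {zero}  f g = refl
  vsum-+ {suc r} f g =
    trans (sum-cong-≗ λ v → vsum-+ (f ∘ (v ∷_)) (g ∘ (v ∷_)))
          (∑-distrib-+ (λ v → vsum (f ∘ (v ∷_))) (λ v → vsum (g ∘ (v ∷_))))

  vsum-* : ∀ {r n} c (f : Vec (Fin n) r → ℕ) → vsum (λ y → c * f y) ≡ c * vsum f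
  vsum-* {zero}  c f = refl
  vsum-* {suc r} c f =
    trans (sum-cong-≗ λ v → vsum-* c (f ∘ (v ∷_)))
          (sym (*-distribˡ-sum c (λ v → vsum (f ∘ (v ∷_)))))

  sum-vsum-comm : ∀ {r m n} (f : Fin m → Vec (Fin n) r → ℕ) →
                  sum (λ i → vsum (f i)) ≡ vsum (λ y → sum (λ i → f i y))
  sum-vsum-comm {zero}  f = refl
  sum-vsum-comm {suc r} f =
    trans (∑-comm λ i v → vsum (f i ∘ (v ∷_)))
          (sum-cong-≗ λ v → sum-vsum-comm λ i → f i ∘ (v ∷_))

  -- Allows any vertex of an ordered clique, not only its head, to be the one singled out.
  vsum-insertAt : ∀ {r n} (f : Vec (Fin n) (suc r) → ℕ) (i : Fin (suc r)) →
                  vsum f ≡ sum (λ u → vsum λ y → f (insertAt y i u))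
  vsum-insertAt f zero = refl
  vsum-insertAt {suc r} f (suc i) =
    trans (sum-cong-≗ λ v → vsum-insertAt (f ∘ (v ∷_)) i)
          (∑-comm λ v u → vsum λ y → f (v ∷ insertAt y i u))

  ι : Bool → ℕ
  ι true  = 1
  ι false = 0

  ι≤1 : ∀ b → ι b ≤ 1
  ι≤1 true  = ≤-refl
  ι≤1 false = z≤n

  ι-does : ∀ {P : Set} (P? : Dec P) → 0 < ι (does P?) → P
  ι-does (yes p) _ = p

  δ : ∀ {n} → Fin n → Fin n → ℕ
  δ u v = ι (does (u Fin.≟ v))

  δ-refl : ∀ {n} (u : Fin n) → δ u u ≡ 1
  δ-refl u = cong ι (dec-true (u Fin.≟ u) refl)

  sum-δ : ∀ {n} (u : Fin n) → sum (δ u) ≡ 1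
  sum-δ {suc n} zero    = cong suc (trans (sum-const n 0) (*-zeroʳ n))
  sum-δ {suc n} (suc u) = sum-δ u

  0<n*m⇒0<n : ∀ n m → 0 < n * m → 0 < n
  0<n*m⇒0<n (suc n) m _ = z<s

  0<n*m⇒0<m : ∀ n m → 0 < n * m → 0 < m
  0<n*m⇒0<m n m lt = 0<n*m⇒0<n m n (subst (0 <_) (*-comm n m) lt)

  -- Complete partite subhypergraphs of dense ordered hypergraphs

  module _ {r n : ℕ} (H : Vec (Fin n) (suc r) → ℕ) (H≤1 : ∀ y → H y ≤ 1) (q : ℕ) where

    linkDegree : Vec (Fin n) r → ℕ
    linkDegree y = sum λ v → H (v ∷ y)

    -- Used as a penalty weight: avoiding the vertices already chosen becomes part of an averaging
    -- argument over all vertices, so that no smaller vertex set has to be formed.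
    hits : ∀ {j} → (Fin j → Fin n) → Fin n → ℕ
    hits x v = sum λ i → δ (x i) v

    sum-hits : ∀ {j} (x : Fin j → Fin n) → sum (hits x) ≡ j
    sum-hits {j} x = begin
      sum (λ v → sum λ i → δ (x i) v) ≡⟨ ∑-comm (λ v i → δ (x i) v) ⟩
      sum (λ i → sum (δ (x i)))       ≡⟨ sum-cong-≗ (sum-δ ∘ x) ⟩
      sum {j} (λ _ → 1)               ≡⟨ sum-const j 1 ⟩
      j * 1                           ≡⟨ *-identityʳ j ⟩
      j                               ∎
      where open ≡-Reasoning

    HighDegree : (Vec (Fin n) r → ℕ) → Set
    HighDegree Y = ∀ y → 0 < Y y → n ≤ 2 * q * linkDegree y

    -- Averaging over `v`. High degree makes the sum of `link` at least `2 * (n * |Y|)`. The sum of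
    -- `bound` is `n * |Y|` plus a penalty for each of the `j` chosen vertices, and `4 * q * j < n`
    -- keeps the total penalty below the other `n * |Y|`.
    popular-vertex : ∀ {j} (x : Fin j → Fin n) Y → 4 * q * j < n → HighDegree Y → 0 < vsum Y →
                     ∃[ v ] hits x v ≡ 0 × vsum Y ≤ 4 * q * vsum (λ y → Y y * H (v ∷ y))
    popular-vertex {j} x Y j<n high 0<Y = unhit (sum-<-witness sum-bound<sum-link)
      where
      open ≤-Reasoning
      |Y| = vsum Y

      link bound : Fin n → ℕ
      link  v = 4 * q * vsum (λ y → Y y * H (v ∷ y))
      -- The penalty `4 * q * |Y|` is the largest value that `link` can take (`link≤`), so a vertex
      -- chosen before never exceeds its bound.
      bound v = |Y| + hits x v * (4 * q * |Y|)

      high′ : ∀ y → n * Y y ≤ Y y * (2 * q * linkDegree y)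
      high′ y with Y y | high y
      ... | zero  | _ = ≤-reflexive (*-zeroʳ n)
      ... | suc m | h = ≤-trans (*-monoˡ-≤ (suc m) (h z<s)) (≤-reflexive (*-comm _ (suc m)))

      sum-link : 2 * (n * |Y|) ≤ sum link
      sum-link = begin
        2 * (n * |Y|)                                       ≡⟨ cong (2 *_) (vsum-* n Y) ⟨
        2 * vsum (λ y → n * Y y)                            ≤⟨ *-monoʳ-≤ 2 (vsum-mono high′) ⟩
        2 * vsum (λ y → Y y * (2 * q * linkDegree y))       ≡⟨ vsum-* 2 (λ y → Y y * (2 * q * linkDegree y)) ⟨
        vsum (λ y → 2 * (Y y * (2 * q * linkDegree y)))     ≡⟨ vsum-cong (λ y → regroup (Y y) q (linkDegree y)) ⟩
        vsum (λ y → 4 * q * (Y y * linkDegree y))           ≡⟨ vsum-* (4 * q) (λ y → Y y * linkDegree y) ⟩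
        4 * q * vsum (λ y → Y y * linkDegree y)             ≡⟨ cong (4 * q *_) (vsum-cong λ y → *-distribˡ-sum (Y y) (λ v → H (v ∷ y))) ⟩
        4 * q * vsum (λ y → sum λ v → Y y * H (v ∷ y))      ≡⟨ cong (4 * q *_) (sum-vsum-comm λ v y → Y y * H (v ∷ y)) ⟨
        4 * q * sum (λ v → vsum λ y → Y y * H (v ∷ y))      ≡⟨ *-distribˡ-sum (4 * q) (λ v → vsum λ y → Y y * H (v ∷ y)) ⟩
        sum link                                            ∎
        where
        regroup : ∀ a q d → 2 * (a * (2 * q * d)) ≡ 4 * q * (a * d)
        regroup = solve-∀

      sum-bound<sum-link : sum bound < sum link
      sum-bound<sum-link = begin-strict
        sum bound                                              ≡⟨ ∑-distrib-+ (λ _ → |Y|) (λ v → hits x v * (4 * q * |Y|)) ⟩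
        sum {n} (λ _ → |Y|) + sum (λ v → hits x v * (4 * q * |Y|)) ≡⟨ cong₂ _+_ (sum-const n |Y|) (sym (*-distribʳ-sum (4 * q * |Y|) (hits x))) ⟩
        n * |Y| + sum (hits x) * (4 * q * |Y|)                 ≡⟨ cong (λ h → n * |Y| + h * (4 * q * |Y|)) (sum-hits x) ⟩
        n * |Y| + j * (4 * q * |Y|)                            ≡⟨ cong (n * |Y| +_) (regroup j q |Y|) ⟩
        n * |Y| + 4 * q * j * |Y|                              <⟨ +-monoʳ-< (n * |Y|) (*-monoˡ-< |Y| {{>-nonZero 0<Y}} j<n) ⟩
        n * |Y| + n * |Y|                                      ≡⟨ cong (n * |Y| +_) (+-identityʳ (n * |Y|)) ⟨
        2 * (n * |Y|)                                          ≤⟨ sum-link ⟩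
        sum link                                               ∎
        where
        regroup : ∀ j q a → j * (4 * q * a) ≡ 4 * q * j * a
        regroup = solve-∀

      link≤ : ∀ v → link v ≤ 4 * q * |Y|
      link≤ v = *-monoʳ-≤ (4 * q) (vsum-mono λ y →
        ≤-trans (*-monoʳ-≤ (Y y) (H≤1 (v ∷ y))) (≤-reflexive (*-identityʳ (Y y))))

      unhit : (∃[ v ] bound v < link v) → ∃[ v ] hits x v ≡ 0 × |Y| ≤ link v
      unhit (v , lt) with hits x v in eq
      ... | zero  = v , eq , ≤-trans (m≤m+n |Y| 0) (<⇒≤ lt)
      ... | suc h = contradiction
        (≤-trans (link≤ v) (≤-trans (m≤m+n _ (h * (4 * q * |Y|))) (m≤n+m _ |Y|))) (<⇒≱ lt)

    private
      CommonLink : ∀ {j} → (Fin j → Fin n) → (Vec (Fin n) r → ℕ) → Set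
      CommonLink x Z = ∀ y → 0 < Z y → ∀ i → 0 < H (x i ∷ y)

    -- `Z` is kept below `Y` so that it inherits the high degree; every further vertex then costs
    -- the same factor `4 * q`.
    dense-common-link : ∀ j Y → 4 * q * j < n → HighDegree Y → 0 < vsum Y →
      Σ[ x ∈ (Fin j → Fin n) ] Σ[ Z ∈ (Vec (Fin n) r → ℕ) ]
        Injective _≡_ _≡_ x × CommonLink x Z × (∀ y → Z y ≤ Y y) × vsum Y ≤ (4 * q) ^ j * vsum Z
    dense-common-link zero Y _ _ _ =
      (λ ()) , Y , (λ { {()} }) , (λ _ _ ()) , (λ _ → ≤-refl) , ≤-reflexive (sym (*-identityˡ _))
    dense-common-link (suc j) Y j<n high 0<Y
      with dense-common-link j Y (≤-<-trans (*-monoʳ-≤ (4 * q) (n≤1+n j)) j<n) high 0<Y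
    ... | x , Z , inj , common , Z≤Y , |Y|≤
      with popular-vertex x Z (≤-<-trans (*-monoʳ-≤ (4 * q) (n≤1+n j)) j<n)
             (λ y 0<Zy → high y (<-≤-trans 0<Zy (Z≤Y y)))
             (0<n*m⇒0<m ((4 * q) ^ j) (vsum Z) (<-≤-trans 0<Y |Y|≤))
    ... | v , unhit , |Z|≤ = x′ , Z′ , inj′ , common′ , Z′≤Y , |Y|≤′
      where
      Z′ : Vec (Fin n) r → ℕ
      Z′ y = Z y * H (v ∷ y)

      x′ : Fin (suc j) → Fin n
      x′ zero    = v
      x′ (suc i) = x i

      fresh : ∀ i → x i ≢ v
      fresh i refl = contradiction
        (≤-trans (≤-reflexive (sym (δ-refl v))) (term≤sum (λ i → δ (x i) v) i))
        (<⇒≱ (s≤s (≤-reflexive unhit)))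

      inj′ : Injective _≡_ _≡_ x′
      inj′ {zero}  {zero}  _  = refl
      inj′ {zero}  {suc k} eq = contradiction (sym eq) (fresh k)
      inj′ {suc i} {zero}  eq = contradiction eq (fresh i)
      inj′ {suc i} {suc k} eq = cong suc (inj eq)

      common′ : CommonLink x′ Z′
      common′ y 0<Z′y zero    = 0<n*m⇒0<m (Z y) (H (v ∷ y)) 0<Z′y
      common′ y 0<Z′y (suc i) = common y (0<n*m⇒0<n (Z y) (H (v ∷ y)) 0<Z′y) i

      Z′≤Y : ∀ y → Z′ y ≤ Y y
      Z′≤Y y = ≤-trans (*-monoʳ-≤ (Z y) (H≤1 (v ∷ y)))
                 (≤-trans (≤-reflexive (*-identityʳ (Z y))) (Z≤Y y))

      |Y|≤′ : vsum Y ≤ (4 * q) ^ suc j * vsum Z′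
      |Y|≤′ = begin
        vsum Y                            ≤⟨ |Y|≤ ⟩
        (4 * q) ^ j * vsum Z              ≤⟨ *-monoʳ-≤ ((4 * q) ^ j) |Z|≤ ⟩
        (4 * q) ^ j * (4 * q * vsum Z′)   ≡⟨ regroup ((4 * q) ^ j) (4 * q) (vsum Z′) ⟩
        (4 * q) ^ suc j * vsum Z′         ∎
        where
        open ≤-Reasoning
        regroup : ∀ p c z → p * (c * z) ≡ c * p * z
        regroup = solve-∀

    highDegree : Vec (Fin n) r → ℕ
    highDegree y = ι (does (n ≤? 2 * q * linkDegree y))

    highDegree-high : HighDegree highDegree
    highDegree-high y = ι-does (n ≤? 2 * q * linkDegree y)

    -- Density makes `2 * q * vsum H` at least `2 * n ^ suc r`. The tuples of low degree supply at
    -- most `n` each, thus at most half of this, and the other half must come from tuples of high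
    -- degree, which supply at most `n * (2 * q)` each.
    vsum-highDegree : 0 < n → n ^ suc r ≤ q * vsum H → n ^ r ≤ 2 * q * vsum highDegree
    vsum-highDegree 0<n dense =
      *-cancelˡ-≤ n {{>-nonZero 0<n}} (+-cancelˡ-≤ (n * n ^ r) _ _ (begin
        n * n ^ r + n * n ^ r                               ≡⟨ cong (n * n ^ r +_) (+-identityʳ _) ⟨
        2 * n ^ suc r                                       ≤⟨ *-monoʳ-≤ 2 dense ⟩
        2 * (q * vsum H)                                    ≡⟨ *-assoc 2 q (vsum H) ⟨
        2 * q * vsum H                                      ≡⟨ cong (2 * q *_) (sum-vsum-comm λ v y → H (v ∷ y)) ⟩
        2 * q * vsum linkDegree                             ≡⟨ vsum-* (2 * q) linkDegree ⟨
        vsum (λ y → 2 * q * linkDegree y)                   ≤⟨ vsum-mono low⊎high ⟩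
        vsum (λ y → n + n * (2 * q) * highDegree y)         ≡⟨ vsum-+ (λ _ → n) (λ y → n * (2 * q) * highDegree y) ⟩
        vsum {r} {n} (λ _ → n) + vsum (λ y → n * (2 * q) * highDegree y)
                                                            ≡⟨ cong₂ _+_ (trans (vsum-const r n n) (*-comm (n ^ r) n)) (vsum-* (n * (2 * q)) highDegree) ⟩
        n * n ^ r + n * (2 * q) * vsum highDegree           ≡⟨ cong (n * n ^ r +_) (*-assoc n (2 * q) _) ⟩
        n * n ^ r + n * (2 * q * vsum highDegree)           ∎))
      where
      open ≤-Reasoning
      linkDegree≤n : ∀ y → linkDegree y ≤ n
      linkDegree≤n y = ≤-trans (sum-mono λ v → H≤1 (v ∷ y))
                         (≤-reflexive (trans (sum-const n 1) (*-identityʳ n)))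

      low⊎high : ∀ y → 2 * q * linkDegree y ≤ n + n * (2 * q) * highDegree y
      low⊎high y = split (n ≤? 2 * q * linkDegree y)
        where
        split : (d : Dec (n ≤ 2 * q * linkDegree y)) → 2 * q * linkDegree y ≤ n + n * (2 * q) * ι (does d)
        split (no  n≰) = ≤-trans (<⇒≤ (≰⇒> n≰)) (m≤m+n n _)
        split (yes _)  = begin
          2 * q * linkDegree y  ≤⟨ *-monoʳ-≤ (2 * q) (linkDegree≤n y) ⟩
          2 * q * n             ≡⟨ *-comm (2 * q) n ⟩
          n * (2 * q)           ≡⟨ *-identityʳ _ ⟨
          n * (2 * q) * 1       ≤⟨ m≤n+m _ n ⟩
          n + n * (2 * q) * 1   ∎

  -- Erdős's theorem on complete r-partite subhypergraphs. Each class is chosen greedily: among the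
  -- tuples with a link of density at least 1/2q, some new vertex keeps a fraction 1/4q of the current ones.
  dense⇒blowup : ∀ r t q → ∃[ n₀ ] (∀ n → n₀ ≤ n → (H : Vec (Fin n) r → ℕ) → (∀ y → H y ≤ 1) →
    n ^ r ≤ q * vsum H →
    Σ[ x ∈ (Fin r → Fin t → Fin n) ] (∀ i → Injective _≡_ _≡_ (x i)) ×
      (∀ (a : Fin r → Fin t) → 0 < H (tabulate λ i → x i (a i))))
  dense⇒blowup zero t q = 0 , λ n _ H _ dense →
    (λ ()) , (λ ()) , λ _ → 0<n*m⇒0<m q (H []) dense
  -- Restricting to tuples of high degree costs `2 * q` and the `t` vertices of the new class cost
  -- `4 * q` each. The product is the inverse density left for the remaining `r` classes.
  dense⇒blowup (suc r) t q with dense⇒blowup r t (2 * q * (4 * q) ^ t)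
  ... | n₀ , blowup = suc (4 * q * t) ⊔ n₀ , blowup′
    where
    blowup′ : ∀ n → suc (4 * q * t) ⊔ n₀ ≤ n → (H : Vec (Fin n) (suc r) → ℕ) → (∀ y → H y ≤ 1) →
      n ^ suc r ≤ q * vsum H →
      Σ[ x ∈ (Fin (suc r) → Fin t → Fin n) ] (∀ i → Injective _≡_ _≡_ (x i)) ×
        (∀ (a : Fin (suc r) → Fin t) → 0 < H (tabulate λ i → x i (a i)))
    blowup′ n n₀≤n H H≤1 dense =
      let t<n = ≤-trans (m≤m⊔n (suc (4 * q * t)) n₀) n₀≤n
          0<n = ≤-<-trans z≤n t<n
          Y   = highDegree H H≤1 q
          |Y| = vsum-highDegree H H≤1 q 0<n dense
          0<Y = 0<n*m⇒0<m (2 * q) (vsum Y) (<-≤-trans (m^n>0 n {{>-nonZero 0<n}} r) |Y|)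
          x₀ , Z , inj₀ , common , Z≤Y , |Z| =
            dense-common-link H H≤1 q t Y t<n (highDegree-high H H≤1 q) 0<Y
          dense′ = ≤-trans |Y| (≤-trans (*-monoʳ-≤ (2 * q) |Z|)
                     (≤-reflexive (sym (*-assoc (2 * q) ((4 * q) ^ t) (vsum Z)))))
          x , inj , full = blowup n (≤-trans (m≤n⊔m (suc (4 * q * t)) n₀) n₀≤n) Z
            (λ y → ≤-trans (Z≤Y y) (ι≤1 _)) dense′
      in  (λ { zero → x₀ ; (suc i) → x i })
        , (λ { zero → inj₀ ; (suc i) → inj i })
        , λ a → common _ (full (a ∘ suc)) (a zero)

  -- Clique counts: Cauchy-Schwarz and a Moon-Moser inequality

  private
    double-product : ∀ x d → 2 * (x * (x + d)) + d * d ≡ x * x + (x + d) * (x + d)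
    double-product = solve-∀

  2xy≤x²+y² : ∀ x y → 2 * (x * y) ≤ x * x + y * y
  2xy≤x²+y² x y with ≤-total x y
  ... | inj₁ x≤y = ordered x≤y
    where
    ordered : ∀ {x y} → x ≤ y → 2 * (x * y) ≤ x * x + y * y
    ordered {x} x≤y with m≤n⇒∃[o]m+o≡n x≤y
    ... | d , refl = ≤-trans (m≤m+n _ (d * d)) (≤-reflexive (double-product x d))
  ... | inj₂ y≤x with m≤n⇒∃[o]m+o≡n y≤x
  ... | d , refl = ≤-trans (≤-reflexive (cong (2 *_) (*-comm (y + d) y)))
        (≤-trans (m≤m+n _ (d * d)) (≤-reflexive (trans (double-product y d) (+-comm (y * y) _))))

  -- A is a 0/1 adjacency matrix.
  module _ {n : ℕ} (A : Fin n → Fin n → ℕ) where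

    common : ∀ {s} → Fin n → Vec (Fin n) s → ℕ
    common v []      = 1
    common v (u ∷ y) = A v u * common v y

    -- Distinctness of the entries is not imposed: for an adjacency matrix with zero diagonal, a
    -- repeated entry already makes the product 0.
    clique : ∀ {s} → Vec (Fin n) s → ℕ
    clique []      = 1
    clique (v ∷ y) = common v y * clique y

    commonDegree : ∀ {s} → Vec (Fin n) s → ℕ
    commonDegree y = sum λ v → common v y

    cliqueCount : ℕ → ℕ
    cliqueCount s = vsum {s} clique

    cliqueDegreeSquareSum : ℕ → ℕ
    cliqueDegreeSquareSum s = vsum {s} λ y → commonDegree y * (commonDegree y * clique y)

    cliqueCount-suc : ∀ s → cliqueCount (suc s) ≡ vsum {s} λ y → commonDegree y * clique y
    cliqueCount-suc s = trans (sum-vsum-comm {s} λ v y → common v y * clique y)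
      (vsum-cong {s} λ y → sym (*-distribʳ-sum (clique y) (λ v → common v y)))

    -- Cauchy–Schwarz: the mean of d(C) over the s-cliques C can only grow when C is weighted by d(C).
    averageDegree-size-biased : ∀ s a b .{{_ : NonZero b}} →
      a * n * cliqueCount s ≤ b * cliqueCount (suc s) →
      a * n * cliqueCount (suc s) ≤ b * cliqueDegreeSquareSum s
    averageDegree-size-biased s a b avg = *-cancelˡ-≤ b (+-cancelˡ-≤ (b * (a * n * N₁)) _ _ (begin
      b * (a * n * N₁) + b * (a * n * N₁)                            ≡⟨ cong (b * (a * n * N₁) +_) (+-identityʳ _) ⟨
      2 * (b * (a * n * N₁))                                         ≡⟨ regroup₀ a b n N₁ ⟩
      2 * (a * n * b) * N₁                                           ≡⟨ cong (2 * (a * n * b) *_) (cliqueCount-suc s) ⟩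
      2 * (a * n * b) * vsum (λ y → D y * C y)                       ≡⟨ vsum-* (2 * (a * n * b)) (λ y → D y * C y) ⟨
      vsum (λ y → 2 * (a * n * b) * (D y * C y))                     ≤⟨ vsum-mono pointwise ⟩
      vsum (λ y → a * n * (a * n) * C y + b * b * (D y * (D y * C y)))
        ≡⟨ vsum-+ (λ y → a * n * (a * n) * C y) (λ y → b * b * (D y * (D y * C y))) ⟩
      vsum (λ y → a * n * (a * n) * C y) + vsum (λ y → b * b * (D y * (D y * C y)))
        ≡⟨ cong₂ _+_ (vsum-* (a * n * (a * n)) C) (vsum-* (b * b) (λ y → D y * (D y * C y))) ⟩
      a * n * (a * n) * N₀ + b * b * S                               ≡⟨ cong₂ _+_ (*-assoc (a * n) (a * n) N₀) (*-assoc b b S) ⟩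
      a * n * (a * n * N₀) + b * (b * S)                             ≤⟨ +-monoˡ-≤ (b * (b * S)) (*-monoʳ-≤ (a * n) avg) ⟩
      a * n * (b * N₁) + b * (b * S)                                 ≡⟨ cong (_+ b * (b * S)) (regroup₁ (a * n) b N₁) ⟩
      b * (a * n * N₁) + b * (b * S)                                 ∎))
      where
      open ≤-Reasoning
      C D : Vec (Fin n) s → ℕ
      C = clique
      D = commonDegree
      N₀ = cliqueCount s
      N₁ = cliqueCount (suc s)
      S = cliqueDegreeSquareSum s
      regroup₀ : ∀ a b n N → 2 * (b * (a * n * N)) ≡ 2 * (a * n * b) * N
      regroup₀ = solve-∀
      regroup₁ : ∀ x b N → x * (b * N) ≡ b * (x * N)
      regroup₁ = solve-∀
      regroup₂ : ∀ x b d c → 2 * (x * b) * (d * c) ≡ 2 * (x * (b * d)) * c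
      regroup₂ = solve-∀
      regroup₃ : ∀ x b d c → (x * x + b * d * (b * d)) * c ≡ x * x * c + b * b * (d * (d * c))
      regroup₃ = solve-∀
      -- Summed over `y`, this is Σ (b d(C) - a n)² ≥ 0 without subtraction. Only `b` is ever
      -- cancelled, so graphs without s-cliques need no separate case.
      pointwise : ∀ y → 2 * (a * n * b) * (D y * C y) ≤ a * n * (a * n) * C y + b * b * (D y * (D y * C y))
      pointwise y = begin
        2 * (a * n * b) * (D y * C y)                               ≡⟨ regroup₂ (a * n) b (D y) (C y) ⟩
        2 * (a * n * (b * D y)) * C y                               ≤⟨ *-monoˡ-≤ (C y) (2xy≤x²+y² (a * n) (b * D y)) ⟩
        (a * n * (a * n) + b * D y * (b * D y)) * C y               ≡⟨ regroup₃ (a * n) b (D y) (C y) ⟩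
        a * n * (a * n) * C y + b * b * (D y * (D y * C y))         ∎

    module _ (A≤1 : ∀ u v → A u v ≤ 1) where

      common≤1 : ∀ {s} v (y : Vec (Fin n) s) → common v y ≤ 1
      common≤1 v []      = ≤-refl
      common≤1 v (u ∷ y) = *-mono-≤ (A≤1 v u) (common≤1 v y)

      clique≤1 : ∀ {s} (y : Vec (Fin n) s) → clique y ≤ 1
      clique≤1 []      = ≤-refl
      clique≤1 (v ∷ y) = *-mono-≤ (common≤1 v y) (clique≤1 y)

      commonDegree≤n : ∀ {s} (y : Vec (Fin n) s) → commonDegree y ≤ n
      commonDegree≤n y = ≤-trans (sum-mono λ v → common≤1 v y)
                           (≤-reflexive (trans (sum-const n 1) (*-identityʳ n)))

      cliqueDegreeSquareSum≤ : ∀ s → cliqueDegreeSquareSum s ≤ n * cliqueCount (suc s)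
      cliqueDegreeSquareSum≤ s = begin
        cliqueDegreeSquareSum s                      ≤⟨ vsum-mono {s} (λ y → *-monoˡ-≤ (commonDegree y * clique y) (commonDegree≤n y)) ⟩
        vsum {s} (λ y → n * (commonDegree y * clique y)) ≡⟨ vsum-* {s} n (λ y → commonDegree y * clique y) ⟩
        n * vsum {s} (λ y → commonDegree y * clique y)   ≡⟨ cong (n *_) (cliqueCount-suc s) ⟨
        n * cliqueCount (suc s)                      ∎
        where open ≤-Reasoning

      -- A vertex that misses some entry of y is joined to at most one of the y with an entry removed.
      common-removeAt : ∀ {s} v (y : Vec (Fin n) (suc s)) →
        sum (λ i → common v (removeAt y i)) ≤ 1 + s * common v y
      common-removeAt v (u ∷ []) = ≤-refl
      common-removeAt {suc s} v (u ∷ y@(_ ∷ _)) with A v u | A≤1 v u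
      ... | zero        | _ = begin
        common v y + sum {suc s} (λ _ → 0)  ≡⟨ cong (common v y +_) (trans (sum-const (suc s) 0) (*-zeroʳ s)) ⟩
        common v y + 0                      ≤⟨ +-monoˡ-≤ 0 (common≤1 v y) ⟩
        1                                   ≤⟨ s≤s z≤n ⟩
        1 + suc s * 0                       ∎
        where open ≤-Reasoning
      ... | suc zero    | _ = begin
        common v y + sum (λ i → common v (removeAt y i) + 0)   ≡⟨ cong (common v y +_) (sum-cong-≗ λ i → +-identityʳ (common v (removeAt y i))) ⟩
        common v y + sum (λ i → common v (removeAt y i))       ≤⟨ +-monoʳ-≤ (common v y) (common-removeAt v y) ⟩
        common v y + (1 + s * common v y)                      ≡⟨ regroup (common v y) s ⟩
        1 + suc s * (common v y + 0)                           ∎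
        where
        open ≤-Reasoning
        regroup : ∀ c s → c + (1 + s * c) ≡ 1 + (1 + s) * (c + 0)
        regroup = solve-∀
      ... | suc (suc _) | s≤s ()

      module _ (A-sym : ∀ u v → A u v ≡ A v u) where

        common-insertAt : ∀ {s} v u (y : Vec (Fin n) s) i → common v (insertAt y i u) ≡ A v u * common v y
        common-insertAt v u y       zero    = refl
        common-insertAt v u (w ∷ y) (suc i) =
          trans (cong (A v w *_) (common-insertAt v u y i)) (swap (A v w) (A v u) (common v y))
          where
          swap : ∀ a b c → a * (b * c) ≡ b * (a * c)
          swap = solve-∀

        clique-insertAt : ∀ {s} u (y : Vec (Fin n) s) i → clique (insertAt y i u) ≡ common u y * clique y
        clique-insertAt u y       zero    = refl
        clique-insertAt u (w ∷ y) (suc i) = begin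
          common w (insertAt y i u) * clique (insertAt y i u)  ≡⟨ cong₂ _*_ (common-insertAt w u y i) (clique-insertAt u y i) ⟩
          A w u * common w y * (common u y * clique y)         ≡⟨ cong (λ a → a * common w y * (common u y * clique y)) (A-sym w u) ⟩
          A u w * common w y * (common u y * clique y)         ≡⟨ swap (A u w) (common w y) (common u y) (clique y) ⟩
          A u w * common u y * (common w y * clique y)         ∎
          where
          open ≡-Reasoning
          swap : ∀ a b c d → a * b * (c * d) ≡ a * c * (b * d)
          swap = solve-∀

        -- One factor of d(C)² counts the vertices that extend C; placing such a vertex at position
        -- `i` turns the pair into an (s+1)-clique with a marked entry. The position is free, and
        -- summing over all of them produces the factor `suc s` in `moon-moser`.
        cliqueDegreeSquareSum-removeAt : ∀ s (i : Fin (suc s)) →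
          cliqueDegreeSquareSum s ≡ vsum (λ y → commonDegree (removeAt y i) * clique y)
        cliqueDegreeSquareSum-removeAt s i = sym (begin
          vsum (λ y → commonDegree (removeAt y i) * clique y)
            ≡⟨ vsum-insertAt (λ y → commonDegree (removeAt y i) * clique y) i ⟩
          sum (λ u → vsum {s} λ y → commonDegree (removeAt (insertAt y i u) i) * clique (insertAt y i u))
            ≡⟨ sum-cong-≗ (λ u → vsum-cong {s} λ y → cong₂ _*_ (cong commonDegree (removeAt-insertAt y i u)) (clique-insertAt u y i)) ⟩
          sum (λ u → vsum {s} λ y → commonDegree y * (common u y * clique y))
            ≡⟨ sum-vsum-comm {s} (λ u y → commonDegree y * (common u y * clique y)) ⟩
          vsum {s} (λ y → sum λ u → commonDegree y * (common u y * clique y))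
            ≡⟨ vsum-cong {s} (λ y → *-distribˡ-sum (commonDegree y) (λ u → common u y * clique y)) ⟨
          vsum {s} (λ y → commonDegree y * sum λ u → common u y * clique y)
            ≡⟨ vsum-cong {s} (λ y → cong (commonDegree y *_) (sym (*-distribʳ-sum (clique y) (λ u → common u y)))) ⟩
          cliqueDegreeSquareSum s ∎)
          where open ≡-Reasoning

        -- This is the Moon-Moser inequality before Cauchy-Schwarz is applied to its left side.
        -- Keeping the sum of squares is what allows the case s = 1 to start from Σ d².
        moon-moser : ∀ s → suc s * cliqueDegreeSquareSum s ≤ n * cliqueCount (suc s) + s * cliqueCount (2 + s)
        moon-moser s = begin
          suc s * cliqueDegreeSquareSum s
            ≡⟨ sum-const (suc s) (cliqueDegreeSquareSum s) ⟨
          sum {suc s} (λ _ → cliqueDegreeSquareSum s)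
            ≡⟨ sum-cong-≗ (cliqueDegreeSquareSum-removeAt s) ⟩
          sum (λ i → vsum {suc s} λ y → commonDegree (removeAt y i) * clique y)
            ≡⟨ sum-vsum-comm {suc s} (λ i y → commonDegree (removeAt y i) * clique y) ⟩
          vsum {suc s} (λ y → sum λ i → commonDegree (removeAt y i) * clique y)
            ≡⟨ vsum-cong {suc s} (λ y → sym (*-distribʳ-sum (clique y) (λ i → commonDegree (removeAt y i)))) ⟩
          vsum {suc s} (λ y → sum (λ i → commonDegree (removeAt y i)) * clique y)
            ≤⟨ vsum-mono {suc s} (λ y → *-monoˡ-≤ (clique y) (commonDegree-removeAt y)) ⟩
          vsum {suc s} (λ y → (n + s * commonDegree y) * clique y)
            ≡⟨ vsum-cong {suc s} (λ y → expand n s (commonDegree y) (clique y)) ⟩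
          vsum {suc s} (λ y → n * clique y + s * (commonDegree y * clique y))
            ≡⟨ vsum-+ {suc s} (λ y → n * clique y) (λ y → s * (commonDegree y * clique y)) ⟩
          vsum {suc s} (λ y → n * clique y) + vsum {suc s} (λ y → s * (commonDegree y * clique y))
            ≡⟨ cong₂ _+_ (vsum-* {suc s} n clique) (vsum-* {suc s} s (λ y → commonDegree y * clique y)) ⟩
          n * cliqueCount (suc s) + s * vsum {suc s} (λ y → commonDegree y * clique y)
            ≡⟨ cong (λ N → n * cliqueCount (suc s) + s * N) (cliqueCount-suc (suc s)) ⟨
          n * cliqueCount (suc s) + s * cliqueCount (2 + s) ∎
          where
          open ≤-Reasoning
          expand : ∀ n s d c → (n + s * d) * c ≡ n * c + s * (d * c)
          expand = solve-∀

          commonDegree-removeAt : (y : Vec (Fin n) (suc s)) →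
            sum (λ i → commonDegree (removeAt y i)) ≤ n + s * commonDegree y
          commonDegree-removeAt y = begin
            sum (λ i → sum λ v → common v (removeAt y i))  ≡⟨ ∑-comm (λ i v → common v (removeAt y i)) ⟩
            sum (λ v → sum λ i → common v (removeAt y i))  ≤⟨ sum-mono (λ v → common-removeAt v y) ⟩
            sum (λ v → 1 + s * common v y)                 ≡⟨ ∑-distrib-+ (λ _ → 1) (λ v → s * common v y) ⟩
            sum {n} (λ _ → 1) + sum (λ v → s * common v y) ≡⟨ cong₂ _+_ (trans (sum-const n 1) (*-identityʳ n)) (sym (*-distribˡ-sum s (λ v → common v y))) ⟩
            n + s * commonDegree y                         ∎

  -- From a large sum of squared degrees to a positive density of (k+1)-cliques

  module _ {n : ℕ} (A : Fin n → Fin n → ℕ) (A≤1 : ∀ u v → A u v ≤ 1) (A-sym : ∀ u v → A u v ≡ A v u) where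

    private
      N S : ℕ → ℕ
      N = cliqueCount A
      S = cliqueDegreeSquareSum A
      d : Fin n → ℕ
      d w = sum (A w)

    cliqueCount-2 : cliqueCount A 2 ≡ sum λ w → sum (A w)
    cliqueCount-2 = sum-cong-≗ λ u → sum-cong-≗ λ v → trans (*-identityʳ _) (*-identityʳ (A u v))

    cliqueDegreeSquareSum-1 : cliqueDegreeSquareSum A 1 ≡ sum λ w → sum (A w) ^ 2
    cliqueDegreeSquareSum-1 = sum-cong-≗ λ w → cong (λ e → e * (e * 1))
      (sum-cong-≗ λ v → trans (*-identityʳ (A v w)) (A-sym v w))

    private
      -- Ordered triangles with first vertex `w`; `sum T` is `N 3` by definition.
      T : Fin n → ℕ
      T w = vsum {2} λ y → common A w y * clique A y

      T≤N₂ : ∀ w → T w ≤ N 2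
      T≤N₂ w = vsum-mono {2} λ y → ≤-trans (*-monoˡ-≤ (clique A y) (common≤1 A A≤1 w y))
                                     (≤-reflexive (*-identityˡ (clique A y)))

      T≤d² : ∀ w → T w ≤ d w * d w
      T≤d² w = begin
        vsum {2} (λ y → common A w y * clique A y) ≤⟨ vsum-mono {2} (λ y → ≤-trans (*-monoʳ-≤ (common A w y) (clique≤1 A A≤1 y)) (≤-reflexive (*-identityʳ (common A w y)))) ⟩
        sum (λ u → sum λ v → A w u * (A w v * 1))  ≡⟨ sum-cong-≗ (λ u → trans (sum-cong-≗ λ v → cong (A w u *_) (*-identityʳ (A w v))) (sym (*-distribˡ-sum (A w u) (A w)))) ⟩
        sum (λ u → A w u * d w)                    ≡⟨ *-distribʳ-sum (d w) (A w) ⟨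
        d w * d w                                  ∎
        where open ≤-Reasoning

      -- The cutoff is degree n/q: below it `T≤d²` gives the term with `n * n`, above it `T≤N₂`
      -- gives the term with `q * q * N 2`. Both are linear in `d w`, so that summation over `w`
      -- produces `N 2` once more.
      T-bound : ∀ q w → n * (q * T w) ≤ (n * n + q * q * N 2) * d w
      T-bound q w with ≤-total (q * d w) n
      ... | inj₁ qd≤n = begin
        n * (q * T w)                       ≤⟨ *-monoʳ-≤ n (*-monoʳ-≤ q (T≤d² w)) ⟩
        n * (q * (d w * d w))               ≡⟨ cong (n *_) (*-assoc q (d w) (d w)) ⟨
        n * (q * d w * d w)                 ≤⟨ *-monoʳ-≤ n (*-monoˡ-≤ (d w) qd≤n) ⟩
        n * (n * d w)                       ≡⟨ *-assoc n n (d w) ⟨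
        n * n * d w                         ≤⟨ *-monoˡ-≤ (d w) (m≤m+n (n * n) (q * q * N 2)) ⟩
        (n * n + q * q * N 2) * d w         ∎
        where open ≤-Reasoning
      ... | inj₂ n≤qd = begin
        n * (q * T w)                       ≤⟨ *-mono-≤ n≤qd (*-monoʳ-≤ q (T≤N₂ w)) ⟩
        q * d w * (q * N 2)                 ≡⟨ regroup q (d w) (N 2) ⟩
        q * q * N 2 * d w                   ≤⟨ *-monoˡ-≤ (d w) (m≤n+m (q * q * N 2) (n * n)) ⟩
        (n * n + q * q * N 2) * d w         ∎
        where
        open ≤-Reasoning
        regroup : ∀ q d N → q * d * (q * N) ≡ q * q * N * d
        regroup = solve-∀

    -- A vertex of degree d lies on at most min(N 2, d²) ≤ d √(N 2) of the ordered triangles;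
    -- T-bound replaces the square root by a weighted mean.
    triangle-bound : ∀ q → n * (q * cliqueCount A 3) ≤ (n * n + q * q * cliqueCount A 2) * cliqueCount A 2
    triangle-bound q = begin
      n * (q * N 3)                                    ≡⟨ *-assoc n q (N 3) ⟨
      n * q * sum T                                    ≡⟨ *-distribˡ-sum (n * q) T ⟩
      sum (λ w → n * q * T w)                          ≡⟨ sum-cong-≗ (λ w → *-assoc n q (T w)) ⟩
      sum (λ w → n * (q * T w))                        ≤⟨ sum-mono (T-bound q) ⟩
      sum (λ w → (n * n + q * q * N 2) * d w)          ≡⟨ *-distribˡ-sum (n * n + q * q * N 2) d ⟨
      (n * n + q * q * N 2) * sum d                    ≡⟨ cong ((n * n + q * q * N 2) *_) cliqueCount-2 ⟨
      (n * n + q * q * N 2) * N 2                      ∎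
      where open ≤-Reasoning

    -- The factor 2 in the hypothesis pays for the term `n * n` of `triangle-bound`: one of the two
    -- copies of n² cancels it and the other remains to be bounded by `q ^ 2 * N 2`.
    triangles⇒dense : ∀ q → 0 < cliqueCount A 2 → 2 * (n * cliqueCount A 2) ≤ q * cliqueCount A 3 →
                      n ^ 2 ≤ q ^ 2 * cliqueCount A 2
    triangles⇒dense q 0<N₂ many = *-cancelʳ-≤ (n ^ 2) _ (N 2) {{>-nonZero 0<N₂}}
      (+-cancelˡ-≤ (n * n * N 2) _ _ (begin
        n * n * N 2 + n ^ 2 * N 2          ≡⟨ regroup n (N 2) ⟩
        n * (2 * (n * N 2))                ≤⟨ *-monoʳ-≤ n many ⟩
        n * (q * N 3)                      ≤⟨ triangle-bound q ⟩
        (n * n + q * q * N 2) * N 2        ≡⟨ expand n q (N 2) ⟩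
        n * n * N 2 + q ^ 2 * N 2 * N 2    ∎))
      where
      open ≤-Reasoning
      regroup : ∀ n N → n * n * N + n * (n * 1) * N ≡ n * (2 * (n * N))
      regroup = solve-∀
      expand : ∀ n q N → (n * n + q * q * N) * N ≡ n * n * N + q * (q * 1) * N * N
      expand = solve-∀

    -- With x = 1/k − 1/(k + e), the coefficient k * k + j * e is k (k + e) (1 − s x), where s + j = k.
    private
      ManyCliques : (k e s j : ℕ) → Set
      ManyCliques k e s j = (k * k + j * e) * n * N (suc s) ≤ k * (k + e) * S s

    -- With t = s + 1, and after division by k (k + e), this is (t + 1)(1 - t x) - 1 = t (1 - (t +
    -- 1) x) applied to `moon-moser`; `coefficients` is that identity with denominators cleared.
    manyCliques-step : ∀ k e s j → suc s + suc j ≡ k → ManyCliques k e (suc s) (suc j) →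
      (k * k + j * e) * n * cliqueCount A (2 + s) ≤ k * (k + e) * cliqueCount A (3 + s)
    manyCliques-step k e s j refl many = *-cancelˡ-≤ (suc s) (+-cancelˡ-≤ (b * (n * N (2 + s))) _ _ (begin
      b * (n * N (2 + s)) + suc s * ((k * k + j * e) * n * N (2 + s))  ≡⟨ coefficients s j e n (N (2 + s)) ⟩
      (2 + s) * ((k * k + suc j * e) * n * N (2 + s))                  ≤⟨ *-monoʳ-≤ (2 + s) many ⟩
      (2 + s) * (b * S (suc s))                                        ≡⟨ swap (2 + s) b (S (suc s)) ⟩
      b * ((2 + s) * S (suc s))                                        ≤⟨ *-monoʳ-≤ b (moon-moser A A≤1 A-sym (suc s)) ⟩
      b * (n * N (2 + s) + suc s * N (3 + s))                          ≡⟨ expand b (n * N (2 + s)) (suc s) (N (3 + s)) ⟩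
      b * (n * N (2 + s)) + suc s * (b * N (3 + s))                    ∎))
      where
      open ≤-Reasoning
      b = k * (k + e)
      coefficients : ∀ s j e n N → let k = suc s + suc j in
        k * (k + e) * (n * N) + suc s * ((k * k + j * e) * n * N) ≡ (2 + s) * ((k * k + suc j * e) * n * N)
      coefficients = solve-∀
      swap : ∀ c b S → c * (b * S) ≡ b * (c * S)
      swap = solve-∀
      expand : ∀ b x s N → b * (x + s * N) ≡ b * x + s * (b * N)
      expand = solve-∀

    -- Dropping `j * e` gives the ratio k/(k + e), the same for every clique size.
    manyCliques-weaken : ∀ k e j s .{{_ : NonZero k}} →
      (k * k + j * e) * n * cliqueCount A s ≤ k * (k + e) * cliqueCount A (suc s) →
      k * (n * cliqueCount A s) ≤ (k + e) * cliqueCount A (suc s)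
    manyCliques-weaken k e j s many = *-cancelˡ-≤ k (begin
      k * (k * (n * N s))                 ≡⟨ regroup k n (N s) ⟩
      k * k * n * N s                     ≤⟨ *-monoˡ-≤ (N s) (*-monoˡ-≤ n (m≤m+n (k * k) (j * e))) ⟩
      (k * k + j * e) * n * N s           ≤⟨ many ⟩
      k * (k + e) * N (suc s)             ≡⟨ *-assoc k (k + e) (N (suc s)) ⟩
      k * ((k + e) * N (suc s))           ∎)
      where
      open ≤-Reasoning
      regroup : ∀ k n N → k * (k * (n * N)) ≡ k * k * n * N
      regroup = solve-∀

    -- Induction on `j`, the number of steps left. The coefficient inequality has to be carried in
    -- its exact form, because a weakened one could not be fed into the next step; only the density
    -- is weakened.
    manyCliques⇒dense : ∀ k e s j → suc s + j ≡ k → ManyCliques k e (suc s) j →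
      n ^ (2 + s) ≤ (k + e) ^ (2 + s) * cliqueCount A (2 + s) →
      n ^ suc k ≤ (k + e) ^ suc k * cliqueCount A (suc k)
    manyCliques⇒dense k e s zero eq _ dense = subst (λ t → n ^ suc t ≤ (k + e) ^ suc t * N (suc t))
      (trans (sym (+-identityʳ (suc s))) eq) dense
    manyCliques⇒dense k@(suc _) e s (suc j) eq many dense =
      manyCliques⇒dense k e (suc s) j (trans (sym (+-suc (suc s) j)) eq)
        (averageDegree-size-biased A (2 + s) (k * k + j * e) (k * (k + e)) next)
        (begin
          n * n ^ (2 + s)                            ≤⟨ *-monoʳ-≤ n dense ⟩
          n * (q ^ (2 + s) * N (2 + s))              ≡⟨ swap n (q ^ (2 + s)) (N (2 + s)) ⟩
          -- A factor `k` is given away here so that the density stays a pure power of 1/(k + e).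
          q ^ (2 + s) * (n * N (2 + s))              ≤⟨ *-monoʳ-≤ (q ^ (2 + s)) (m≤n*m (n * N (2 + s)) k) ⟩
          q ^ (2 + s) * (k * (n * N (2 + s)))        ≤⟨ *-monoʳ-≤ (q ^ (2 + s)) (manyCliques-weaken k e j (2 + s) next) ⟩
          q ^ (2 + s) * (q * N (3 + s))              ≡⟨ regroup (q ^ (2 + s)) q (N (3 + s)) ⟩
          q ^ (3 + s) * N (3 + s)                    ∎)
      where
      open ≤-Reasoning
      q = k + e
      next = manyCliques-step k e s j eq many
      swap : ∀ x y z → x * (y * z) ≡ y * (x * z)
      swap = solve-∀
      regroup : ∀ x y z → x * (y * z) ≡ y * x * z
      regroup = solve-∀

    -- The hypothesis is the failure of the bound with 1/(k + e) in place of ε: k (k + e) (1 - 1/k +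
    -- 1/(k + e)) = k² + (k - 1) e, and `suc j` is k - 1.
    degreeSquares⇒manyCliques : ∀ j e → let k = 2 + j in
      (k * k + suc j * e) * n * cliqueCount A 2 < k * (k + e) * cliqueDegreeSquareSum A 1 →
      n ^ suc k ≤ (k + e) ^ suc k * cliqueCount A (suc k)
    degreeSquares⇒manyCliques j e large =
      manyCliques⇒dense k e 0 (suc j) refl (<⇒≤ large) (triangles⇒dense (k + e) 0<N₂ (begin
        -- Here `k ≥ 2` supplies the factor 2 that `triangles⇒dense` asks for.
        2 * (n * N 2)   ≤⟨ *-monoˡ-≤ (n * N 2) (m≤m+n 2 j) ⟩
        k * (n * N 2)   ≤⟨ manyCliques-weaken k e j 2 (manyCliques-step k e 0 j refl (<⇒≤ large)) ⟩
        (k + e) * N 3   ∎))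
      where
      open ≤-Reasoning
      k = 2 + j
      -- The strictness of the violation excludes edgeless graphs.
      0<N₂ : 0 < N 2
      0<N₂ = 0<n*m⇒0<m n (N 2) (<-≤-trans
        (0<n*m⇒0<m (k * (k + e)) (S 1) (≤-<-trans z≤n large))
        (cliqueDegreeSquareSum≤ A A≤1 1))

  -- Graphs: degrees, edges, and copies of F inside a blow-up

  ∣tabulate∣ : ∀ {n} (b : Fin n → Bool) → ∣ tabulate b ∣ ≡ sum (ι ∘ b)
  ∣tabulate∣ {zero}  b = refl
  ∣tabulate∣ {suc n} b with b zero
  ... | true  = cong suc (∣tabulate∣ (b ∘ suc))
  ... | false = ∣tabulate∣ (b ∘ suc)

  adjacency : ∀ {n} → Graph n → Fin n → Fin n → ℕ
  adjacency G u v = ι (does (u ~? v))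
    where open Graph G

  module _ {n : ℕ} (G : Graph n) where
    open Graph G using (_~_; _~?_; ~-sym; ~-irrefl)

    private
      A : Fin n → Fin n → ℕ
      A = adjacency G

    adjacency≤1 : ∀ u v → adjacency G u v ≤ 1
    adjacency≤1 u v = ι≤1 (does (u ~? v))

    adjacency-sym : ∀ u v → adjacency G u v ≡ adjacency G v u
    adjacency-sym u v with u ~? v
    ... | yes u~v = sym (cong ι (dec-true (v ~? u) (~-sym u~v)))
    ... | no  u≁v = sym (cong ι (dec-false (v ~? u) (u≁v ∘ ~-sym)))

    degree≡sum : ∀ v → degree G v ≡ sum (adjacency G v)
    degree≡sum v = ∣tabulate∣ λ u → does (v ~? u)

    degreeSquareSum≡ : degreeSquareSum G ≡ cliqueDegreeSquareSum (adjacency G) 1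
    degreeSquareSum≡ = trans (sum-cong-≗ λ v → cong (_^ 2) (degree≡sum v))
      (sym (cliqueDegreeSquareSum-1 A adjacency≤1 adjacency-sym))

    private
      orientedEdge : Fin n → Fin n → ℕ
      orientedEdge u v = ι (does (u Fin.<? v) ∧ does (u ~? v))

      orientedEdge-< : ∀ {u v} → u Fin.< v → orientedEdge u v ≡ A u v
      orientedEdge-< {u} {v} u<v = cong (λ b → ι (b ∧ does (u ~? v))) (dec-true (u Fin.<? v) u<v)

      orientedEdge-≮ : ∀ {u v} → ¬ u Fin.< v → orientedEdge u v ≡ 0
      orientedEdge-≮ {u} {v} u≮v = cong (λ b → ι (b ∧ does (u ~? v))) (dec-false (u Fin.<? v) u≮v)

      orient : ∀ u v → orientedEdge u v + orientedEdge v u ≡ A u v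
      orient u v with Finₚ.<-cmp u v
      ... | tri< u<v _ v≮u = trans (cong₂ _+_ (orientedEdge-< u<v) (orientedEdge-≮ v≮u)) (+-identityʳ _)
      ... | tri> u≮v _ v<u = trans (cong₂ _+_ (orientedEdge-≮ u≮v) (orientedEdge-< v<u)) (adjacency-sym v u)
      ... | tri≈ u≮u refl _ = trans (cong₂ _+_ (orientedEdge-≮ u≮u) (orientedEdge-≮ u≮u))
                                (sym (cong ι (dec-false (u ~? u) (~-irrefl refl))))

    handshake : sum (degree G) ≡ 2 * edgeCount G
    handshake = begin
      sum (degree G)                                                         ≡⟨ sum-cong-≗ degree≡sum ⟩
      sum (λ u → sum λ v → A u v)                                            ≡⟨ sum-cong-≗ (λ u → sum-cong-≗ λ v → sym (orient u v)) ⟩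
      sum (λ u → sum λ v → E u v + E v u)                                    ≡⟨ sum-cong-≗ (λ u → ∑-distrib-+ (E u) (λ v → E v u)) ⟩
      sum (λ u → sum (E u) + sum λ v → E v u)                                ≡⟨ ∑-distrib-+ (λ u → sum (E u)) (λ u → sum λ v → E v u) ⟩
      sum (λ u → sum (E u)) + sum (λ u → sum λ v → E v u)                    ≡⟨ cong (sum (λ u → sum (E u)) +_) (∑-comm λ u v → E v u) ⟩
      sum (λ u → sum (E u)) + sum (λ u → sum (E u))                          ≡⟨ cong₂ _+_ oriented (trans oriented (sym (+-identityʳ _))) ⟩
      2 * edgeCount G                                                        ∎
      where
      open ≡-Reasoning
      E = orientedEdge
      oriented : sum (λ u → sum (E u)) ≡ edgeCount G
      oriented = sum-cong-≗ λ u → sym (∣tabulate∣ λ v → does (u Fin.<? v) ∧ does (u ~? v))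

    cliqueCount-2≡ : cliqueCount (adjacency G) 2 ≡ 2 * edgeCount G
    cliqueCount-2≡ = trans (cliqueCount-2 A adjacency≤1 adjacency-sym)
      (trans (sym (sum-cong-≗ degree≡sum)) handshake)

    common⇒adjacent : ∀ {s} v (x : Fin s → Fin n) → 0 < common (adjacency G) v (tabulate x) → ∀ i → v ~ x i
    common⇒adjacent v x pos zero    =
      ι-does (v ~? x zero) (0<n*m⇒0<n (A v (x zero)) (common A v (tabulate (x ∘ suc))) pos)
    common⇒adjacent v x pos (suc i) =
      common⇒adjacent v (x ∘ suc) (0<n*m⇒0<m (A v (x zero)) (common A v (tabulate (x ∘ suc))) pos) i

    clique⇒adjacent : ∀ {s} (x : Fin s → Fin n) → 0 < clique (adjacency G) (tabulate x) →
                      ∀ i j → i ≢ j → x i ~ x j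
    clique⇒adjacent {suc s} x pos = adjacent
      where
      rest = tabulate (x ∘ suc)
      head~ = common⇒adjacent (x zero) (x ∘ suc) (0<n*m⇒0<n (common A (x zero) rest) (clique A rest) pos)
      adjacent : ∀ i j → i ≢ j → x i ~ x j
      adjacent zero    zero    i≢j = contradiction refl i≢j
      adjacent zero    (suc j) _   = head~ j
      adjacent (suc i) zero    _   = ~-sym (head~ i)
      adjacent (suc i) (suc j) i≢j =
        clique⇒adjacent (x ∘ suc) (0<n*m⇒0<m (common A (x zero) rest) (clique A rest) pos) i j (i≢j ∘ cong suc)

    -- Each class has room for all of F, so `u` takes place number `u` in the class of its colour.
    -- The classes are not known to be disjoint, but vertices placed in different classes are
    -- adjacent in G and hence distinct.
    blowup⇒copy : ∀ {f c} {F : Graph f} → Colorable F c → (x : Fin c → Fin f → Fin n) →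
      (∀ i → Injective _≡_ _≡_ (x i)) →
      (∀ a → 0 < clique (adjacency G) (tabulate λ i → x i (a i))) → Copy F G
    blowup⇒copy {f} {c} (col , proper) x inj full = record
      { embed     = λ u → x (col u) u
      ; injective = embed-injective
      ; edges     = λ {u} {v} u~v → adjacent u v (proper u~v)
      }
      where
      adjacent : ∀ u v → col u ≢ col v → x (col u) u ~ x (col v) v
      adjacent u v cu≢cv = subst₂ (λ s t → x (col u) s ~ x (col v) t) at-u at-v
        (clique⇒adjacent (λ i → x i (choose i)) (full choose) (col u) (col v) cu≢cv)
        where
        choose : Fin c → Fin f
        -- `full` expects a vertex from every class; outside the two colours concerned, `v` serves
        -- as a default.
        choose i = if does (i Fin.≟ col u) then u else v
        at-u : choose (col u) ≡ u
        at-u = cong (if_then u else v) (dec-true (col u Fin.≟ col u) refl)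
        at-v : choose (col v) ≡ v
        at-v = cong (if_then u else v) (dec-false (col v Fin.≟ col u) (cu≢cv ∘ sym))

      embed-injective : Injective _≡_ _≡_ (λ u → x (col u) u)
      embed-injective {u} {v} eq with col u Fin.≟ col v
      ... | yes cu≡cv = inj (col v) (trans (cong (λ i → x i u) (sym cu≡cv)) eq)
      ... | no  cu≢cv = contradiction (adjacent u v cu≢cv) (~-irrefl eq)

  free⇒degreeSquareSum-bound : ∀ j e {f} (F : Graph f) → let k = 2 + j in Colorable F (suc k) →
    ∃[ n₀ ] (∀ n → n₀ ≤ n → (G : Graph n) → F -Free G →
      k * (k + e) * degreeSquareSum G ≤ (k * k + suc j * e) * n * (2 * edgeCount G))
  free⇒degreeSquareSum-bound j e {f} F colorable =
    map₂ bound (dense⇒blowup (suc k) f ((k + e) ^ suc k))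
    where
    k = 2 + j
    bound : ∀ {n₀} → (∀ n → n₀ ≤ n → (H : Vec (Fin n) (suc k) → ℕ) → (∀ y → H y ≤ 1) →
        n ^ suc k ≤ (k + e) ^ suc k * vsum H →
        Σ[ x ∈ (Fin (suc k) → Fin f → Fin n) ] (∀ i → Injective _≡_ _≡_ (x i)) ×
          (∀ a → 0 < H (tabulate λ i → x i (a i)))) →
      ∀ n → n₀ ≤ n → (G : Graph n) → F -Free G →
      k * (k + e) * degreeSquareSum G ≤ (k * k + suc j * e) * n * (2 * edgeCount G)
    bound blowup n n₀≤n G free =
      subst₂ (λ S N → k * (k + e) * S ≤ (k * k + suc j * e) * n * N)
        (sym (degreeSquareSum≡ G)) (cliqueCount-2≡ G) (≮⇒≥ λ large →
          let A≤1 = adjacency≤1 G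
              x , inj , full = blowup n n₀≤n (clique (adjacency G)) (clique≤1 (adjacency G) A≤1)
                (degreeSquares⇒manyCliques (adjacency G) A≤1 (adjacency-sym G) j e large)
          in free (blowup⇒copy G colorable x inj full))

  -- The equality cases: complete bipartite and Turán graphs

  sum-≤-tight : ∀ {n} {f g : Fin n → ℕ} → (∀ i → f i ≤ g i) → sum f ≡ sum g → ∀ i → f i ≡ g i
  sum-≤-tight {suc n} {f} {g} f≤g eq = tight
    where
    f₀≡g₀ : f zero ≡ g zero
    f₀≡g₀ = ≤-antisym (f≤g zero) (+-cancelʳ-≤ (sum (f ∘ suc)) (g zero) (f zero)
      (≤-trans (+-monoʳ-≤ (g zero) (sum-mono (f≤g ∘ suc))) (≤-reflexive (sym eq))))

    tight : ∀ i → f i ≡ g i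
    tight zero    = f₀≡g₀
    tight (suc i) = sum-≤-tight (f≤g ∘ suc)
      (+-cancelˡ-≡ (f zero) _ _ (trans eq (cong (_+ sum (g ∘ suc)) (sym f₀≡g₀)))) i

  -- If some `p i` lies below `c`, balance bounds every part by `c`; the total `c * k` then leaves
  -- no slack and forces `p i ≡ c` after all. The case above `c` is symmetric.
  balanced⇒constant : ∀ {k} c (p : Fin k → ℕ) → (∀ i j → p i ≤ p j + 1) → sum p ≡ c * k → ∀ i → p i ≡ c
  balanced⇒constant {k} c p balanced total i with <-cmp (p i) c
  ... | tri≈ _ eq _   = eq
  ... | tri< pi<c _ _ = sum-≤-tight (λ j → ≤-trans (balanced j i) (≤-trans (≤-reflexive (+-comm (p i) 1)) pi<c))
                          (trans total (trans (*-comm c k) (sym (sum-const k c)))) i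
  ... | tri> _ _ c<pi = sym (sum-≤-tight
                          (λ j → +-cancelʳ-≤ 1 c (p j) (≤-trans (≤-reflexive (+-comm c 1)) (≤-trans c<pi (balanced i j))))
                          (sym (trans total (trans (*-comm c k) (sym (sum-const k c))))) i)

  sum-δ-select : ∀ {n} (u : Fin n) (g : Fin n → ℕ) → sum (λ i → δ u i * g i) ≡ g u
  sum-δ-select {suc n} zero    g =
    trans (cong₂ _+_ (+-identityʳ (g zero)) (trans (sum-const n 0) (*-zeroʳ n))) (+-identityʳ (g zero))
  sum-δ-select {suc n} (suc u) g = sum-δ-select u (g ∘ suc)

  module _ {n k : ℕ} (part : Fin n → Fin k) where

    partSize≡ : ∀ i → partSize part i ≡ sum λ v → δ (part v) i
    partSize≡ i = ∣tabulate∣ λ v → does (part v Fin.≟ i)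

    sum-fibres : ∀ (g : Fin k → ℕ) → sum (g ∘ part) ≡ sum λ i → partSize part i * g i
    sum-fibres g = begin
      sum (g ∘ part)                              ≡⟨ sum-cong-≗ (λ v → sum-δ-select (part v) g) ⟨
      sum (λ v → sum λ i → δ (part v) i * g i)    ≡⟨ ∑-comm (λ v i → δ (part v) i * g i) ⟩
      sum (λ i → sum λ v → δ (part v) i * g i)    ≡⟨ sum-cong-≗ (λ i → sym (*-distribʳ-sum (g i) (λ v → δ (part v) i))) ⟩
      sum (λ i → sum (λ v → δ (part v) i) * g i)  ≡⟨ sum-cong-≗ (λ i → cong (_* g i) (sym (partSize≡ i))) ⟩
      sum (λ i → partSize part i * g i)           ∎
      where open ≡-Reasoning

    sum-partSize : sum (partSize part) ≡ n
    sum-partSize = begin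
      sum (partSize part)                 ≡⟨ sum-cong-≗ (λ i → *-identityʳ (partSize part i)) ⟨
      sum (λ i → partSize part i * 1)     ≡⟨ sum-fibres (λ _ → 1) ⟨
      sum {n} (λ _ → 1)                   ≡⟨ sum-const n 1 ⟩
      n * 1                               ≡⟨ *-identityʳ n ⟩
      n                                   ∎
      where open ≡-Reasoning

    module _ (G : Graph n) (complete : IsCompletePartition G part) where
      open Graph G using (_~?_)

      -- The non-neighbours of `v`, with `v` itself among them, are exactly its class.
      degree+partSize : ∀ v → degree G v + partSize part (part v) ≡ n
      degree+partSize v = begin
        degree G v + partSize part (part v)                          ≡⟨ cong₂ _+_ (degree≡sum G v) (partSize≡ (part v)) ⟩
        sum (adjacency G v) + sum (λ u → δ (part u) (part v))        ≡⟨ ∑-distrib-+ (adjacency G v) (λ u → δ (part u) (part v)) ⟨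
        sum (λ u → adjacency G v u + δ (part u) (part v))            ≡⟨ sum-cong-≗ dichotomy ⟩
        sum {n} (λ _ → 1)                                            ≡⟨ sum-const n 1 ⟩
        n * 1                                                        ≡⟨ *-identityʳ n ⟩
        n                                                            ∎
        where
        open ≡-Reasoning
        dichotomy : ∀ u → adjacency G v u + δ (part u) (part v) ≡ 1
        dichotomy u with v ~? u
        ... | yes v~u = cong (λ b → 1 + ι b) (dec-false (part u Fin.≟ part v) (Equivalence.to (complete v u) v~u ∘ sym))
        ... | no  v≁u with part u Fin.≟ part v
        ...   | yes _     = refl
        ...   | no  pu≢pv = contradiction (Equivalence.from (complete v u) (pu≢pv ∘ sym)) v≁u

  -- With classes of sizes p and q, Σ d² = p q² + q p² = p q (p + q) = m n, balanced or not. The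
  -- equation is the claim for k = 2 multiplied by k, with its negative term moved to the left.
  bipartite-degreeSquareSum : ∀ {n} (G : Graph n) → IsCompleteBipartite G →
    2 * degreeSquareSum G + n * (2 * edgeCount G) ≡ 2 * n * (2 * edgeCount G)
  bipartite-degreeSquareSum {n} G (part , complete) = begin
    2 * degreeSquareSum G + n * (2 * edgeCount G)      ≡⟨ cong₂ (λ S N → 2 * S + n * N) squares (trans (sym (handshake G)) degrees) ⟩
    -- The trailing `* 1` and `+ 0` are what `^ 2` and sums over `Fin 2` unfold to.
    2 * (p * (q * (q * 1)) + (q * (p * (p * 1)) + 0)) + n * (p * q + (q * p + 0))
                                                       ≡⟨ cong (λ m → 2 * (p * (q * (q * 1)) + (q * (p * (p * 1)) + 0)) + m * (p * q + (q * p + 0))) p+q≡n ⟨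
    2 * (p * (q * (q * 1)) + (q * (p * (p * 1)) + 0)) + (p + q) * (p * q + (q * p + 0))
                                                       ≡⟨ identity p q ⟩
    2 * (p + q) * (p * q + (q * p + 0))                ≡⟨ cong₂ (λ m N → 2 * m * N) p+q≡n (trans (sym degrees) (handshake G)) ⟩
    2 * n * (2 * edgeCount G)                          ∎
    where
    open ≡-Reasoning
    p q : ℕ
    p = partSize part zero
    q = partSize part (suc zero)

    p+q≡n : p + q ≡ n
    p+q≡n = trans (cong (p +_) (sym (+-identityʳ q))) (sum-partSize part)

    opposite : Fin 2 → ℕ
    opposite zero       = q
    opposite (suc zero) = p

    degree≡opposite : ∀ v → degree G v ≡ opposite (part v)
    degree≡opposite v = cancel (part v) (degree+partSize part G complete v)
      where
      cancel : ∀ i → degree G v + partSize part i ≡ n → degree G v ≡ opposite i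
      cancel zero       eq = +-cancelʳ-≡ p _ q (trans eq (trans (sym p+q≡n) (+-comm p q)))
      cancel (suc zero) eq = +-cancelʳ-≡ q _ p (trans eq (sym p+q≡n))

    degrees : sum (degree G) ≡ p * q + (q * p + 0)
    degrees = trans (sum-cong-≗ degree≡opposite) (sum-fibres part opposite)

    squares : degreeSquareSum G ≡ p * (q * (q * 1)) + (q * (p * (p * 1)) + 0)
    squares = trans (sum-cong-≗ λ v → cong (_^ 2) (degree≡opposite v)) (sum-fibres part λ i → opposite i ^ 2)

    identity : ∀ p q → 2 * (p * (q * (q * 1)) + (q * (p * (p * 1)) + 0)) + (p + q) * (p * q + (q * p + 0))
                     ≡ 2 * (p + q) * (p * q + (q * p + 0))
    identity = solve-∀

  -- When k divides n every degree is n - n/k. Once 2m is replaced by the sum of the degrees, the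
  -- equation therefore holds at each vertex separately.
  turán-degreeSquareSum : ∀ {n k} (G : Graph n) → k ∣ n → IsTurán G k →
    k * degreeSquareSum G + n * (2 * edgeCount G) ≡ k * n * (2 * edgeCount G)
  turán-degreeSquareSum {n} {k} G (divides c refl) (part , complete , balanced) = begin
    k * degreeSquareSum G + n * (2 * edgeCount G)    ≡⟨ cong (λ N → k * degreeSquareSum G + n * N) (handshake G) ⟨
    k * degreeSquareSum G + n * sum d                ≡⟨ cong₂ _+_ (*-distribˡ-sum k (λ v → d v ^ 2)) (*-distribˡ-sum n d) ⟩
    sum (λ v → k * d v ^ 2) + sum (λ v → n * d v)    ≡⟨ ∑-distrib-+ (λ v → k * d v ^ 2) (λ v → n * d v) ⟨
    sum (λ v → k * d v ^ 2 + n * d v)                ≡⟨ sum-cong-≗ regular ⟩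
    sum (λ v → k * n * d v)                          ≡⟨ *-distribˡ-sum (k * n) d ⟨
    k * n * sum d                                    ≡⟨ cong (k * n *_) (handshake G) ⟩
    k * n * (2 * edgeCount G)                        ∎
    where
    open ≡-Reasoning
    d : Fin n → ℕ
    d = degree G

    d+c≡n : ∀ v → d v + c ≡ n
    d+c≡n v = trans (cong (d v +_) (sym (balanced⇒constant c (partSize part) balanced (sum-partSize part) (part v))))
                (degree+partSize part G complete v)

    factor : ∀ k c d → k * (d * (d * 1)) + c * k * d ≡ k * (d + c) * d
    factor = solve-∀

    regular : ∀ v → k * d v ^ 2 + n * d v ≡ k * n * d v
    regular v = trans (factor k c (d v)) (cong (λ m → k * m * d v) (d+c≡n v))

-- Transfer from natural numbers to the rational statement

module _ where
  open import Data.Nat as ℕ using (suc)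
  import Data.Nat.Properties as ℕₚ
  open import Data.Integer as ℤ using (+_)
  import Data.Integer.Properties as ℤₚ
  open import Data.Rational
  open import Data.Rational.Properties
  open import Data.Rational.Solver using (module +-*-Solver)
  open import Data.Rational.Unnormalised as ℚᵘ using (mkℚᵘ; *≡*; *≤*)
  import Data.Rational.Unnormalised.Properties as ℚᵘₚ
  open import Relation.Binary.PropositionalEquality

  -- `fromℕ` normalises its fraction and does not compute on a variable; the unnormalised fraction
  -- does, so the laws below are checked there.
  toℚᵘ-fromℕ : ∀ n → toℚᵘ (fromℕ n) ℚᵘ.≃ mkℚᵘ (+ n) 0
  toℚᵘ-fromℕ n = toℚᵘ-fromℚᵘ (mkℚᵘ (+ n) 0)

  fromℕ-+ : ∀ m n → fromℕ (m ℕ.+ n) ≡ fromℕ m + fromℕ n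
  fromℕ-+ m n = toℚᵘ-injective (begin-equality
    toℚᵘ (fromℕ (m ℕ.+ n))                       ≃⟨ toℚᵘ-fromℕ (m ℕ.+ n) ⟩
    mkℚᵘ (+ (m ℕ.+ n)) 0                         ≃⟨ *≡* (cong (ℤ._* + 1) (cong₂ ℤ._+_ (ℤₚ.*-identityʳ (+ m)) (ℤₚ.*-identityʳ (+ n)))) ⟨
    mkℚᵘ (+ m) 0 ℚᵘ.+ mkℚᵘ (+ n) 0               ≃⟨ ℚᵘₚ.+-cong (toℚᵘ-fromℕ m) (toℚᵘ-fromℕ n) ⟨
    toℚᵘ (fromℕ m) ℚᵘ.+ toℚᵘ (fromℕ n)           ≃⟨ toℚᵘ-homo-+ (fromℕ m) (fromℕ n) ⟨
    toℚᵘ (fromℕ m + fromℕ n)                     ∎)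
    where open ℚᵘₚ.≤-Reasoning

  fromℕ-* : ∀ m n → fromℕ (m ℕ.* n) ≡ fromℕ m * fromℕ n
  fromℕ-* m n = toℚᵘ-injective (begin-equality
    toℚᵘ (fromℕ (m ℕ.* n))                       ≃⟨ toℚᵘ-fromℕ (m ℕ.* n) ⟩
    mkℚᵘ (+ (m ℕ.* n)) 0                         ≃⟨ *≡* (cong (ℤ._* + 1) (ℤₚ.pos-* m n)) ⟩
    mkℚᵘ (+ m) 0 ℚᵘ.* mkℚᵘ (+ n) 0               ≃⟨ ℚᵘₚ.*-cong (toℚᵘ-fromℕ m) (toℚᵘ-fromℕ n) ⟨
    toℚᵘ (fromℕ m) ℚᵘ.* toℚᵘ (fromℕ n)           ≃⟨ toℚᵘ-homo-* (fromℕ m) (fromℕ n) ⟨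
    toℚᵘ (fromℕ m * fromℕ n)                     ∎)
    where open ℚᵘₚ.≤-Reasoning

  fromℕ-mono-≤ : ∀ {m n} → m ℕ.≤ n → fromℕ m ≤ fromℕ n
  fromℕ-mono-≤ {m} {n} m≤n = toℚᵘ-cancel-≤ (begin
    toℚᵘ (fromℕ m)   ≃⟨ toℚᵘ-fromℕ m ⟩
    mkℚᵘ (+ m) 0     ≤⟨ *≤* (ℤₚ.*-monoʳ-≤-nonNeg (+ 1) (ℤ.+≤+ m≤n)) ⟩
    mkℚᵘ (+ n) 0     ≃⟨ toℚᵘ-fromℕ n ⟨
    toℚᵘ (fromℕ n)   ∎)
    where open ℚᵘₚ.≤-Reasoning

  fromℕ-nonNeg : ∀ n → NonNegative (fromℕ n)
  fromℕ-nonNeg n = nonNegative (fromℕ-mono-≤ {0} {n} ℕ.z≤n)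

  fromℕ-pos : ∀ n .{{_ : ℕ.NonZero n}} → Positive (fromℕ n)
  fromℕ-pos n@(suc _) = normalize-pos n 1

  1/n*n≡1 : ∀ n .{{_ : ℕ.NonZero n}} → (+ 1 / n) * fromℕ n ≡ 1ℚ
  1/n*n≡1 n@(suc m) = toℚᵘ-injective (begin-equality
    toℚᵘ ((+ 1 / n) * fromℕ n)             ≃⟨ toℚᵘ-homo-* (+ 1 / n) (fromℕ n) ⟩
    toℚᵘ (+ 1 / n) ℚᵘ.* toℚᵘ (fromℕ n)     ≃⟨ ℚᵘₚ.*-cong (toℚᵘ-fromℚᵘ (mkℚᵘ (+ 1) m)) (toℚᵘ-fromℕ n) ⟩
    mkℚᵘ (+ 1) m ℚᵘ.* mkℚᵘ (+ n) 0         ≃⟨ *≡* (trans (ℤₚ.*-identityʳ (+ 1 ℤ.* + n)) (cong (λ t → + 1 ℤ.* + t) (sym (ℕₚ.*-identityʳ n)))) ⟩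
    toℚᵘ 1ℚ                                ∎)
    where open ℚᵘₚ.≤-Reasoning

  -- The product is the numerator of ε, a positive integer. This makes the denominator an explicit
  -- Archimedean witness.
  denominator-clears : ∀ ε → 0ℚ < ε → 1ℚ ≤ ε * fromℕ (↧ₙ ε)
  denominator-clears ε 0<ε with positive 0<ε
  denominator-clears ε@(mkℚ ℤ.+[1+ a ] d _) 0<ε | _ = toℚᵘ-cancel-≤ (begin
    toℚᵘ 1ℚ                                  ≤⟨ *≤* (ℤ.+≤+ numerator≥denominator) ⟩
    mkℚᵘ (ℤ.+[1+ a ] ℤ.* + suc d) d          ≃⟨ *≡* (cong (λ t → ℤ.+[1+ a ] ℤ.* + suc d ℤ.* + t) (sym (ℕₚ.*-identityʳ (suc d)))) ⟨
    toℚᵘ ε ℚᵘ.* mkℚᵘ (+ suc d) 0             ≃⟨ ℚᵘₚ.*-congˡ {toℚᵘ ε} (toℚᵘ-fromℕ (suc d)) ⟨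
    toℚᵘ ε ℚᵘ.* toℚᵘ (fromℕ (suc d))         ≃⟨ toℚᵘ-homo-* ε (fromℕ (suc d)) ⟨
    toℚᵘ (ε * fromℕ (suc d))                 ∎)
    where
    open ℚᵘₚ.≤-Reasoning
    numerator≥denominator : 1 ℕ.* suc d ℕ.≤ suc a ℕ.* suc d ℕ.* 1
    numerator≥denominator = ℕₚ.≤-trans (ℕₚ.*-monoˡ-≤ (suc d) (ℕ.s≤s (ℕ.z≤n {a}))) (ℕₚ.≤-reflexive (sym (ℕₚ.*-identityʳ (suc a ℕ.* suc d))))

  scaled⇒≡ : ∀ k .{{_ : ℕ.NonZero k}} S n m → k ℕ.* S ℕ.+ n ℕ.* (2 ℕ.* m) ≡ k ℕ.* n ℕ.* (2 ℕ.* m) →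
             fromℕ S ≡ fromℕ 2 * (1ℚ - + 1 / k) * fromℕ m * fromℕ n
  scaled⇒≡ k S n m eq = begin
    s                                                ≡⟨ *-identityʳ s ⟨
    s * 1ℚ                                           ≡⟨ cong (s *_) (1/n*n≡1 k) ⟨
    s * (i * κ)                                      ≡⟨ solve 5 (λ s i κ ν μ → s :* (i :* κ) := i :* (κ :* s :+ ν :* μ) :- i :* (ν :* μ)) refl s i κ ν (fromℕ 2 * μ) ⟩
    i * (κ * s + ν * (fromℕ 2 * μ)) - i * (ν * (fromℕ 2 * μ))
                                                     ≡⟨ cong (λ t → i * t - i * (ν * (fromℕ 2 * μ))) eqℚ ⟩
    i * (κ * ν * (fromℕ 2 * μ)) - i * (ν * (fromℕ 2 * μ))
                                                     ≡⟨ solve 5 (λ t i κ ν μ → i :* (κ :* ν :* (t :* μ)) :- i :* (ν :* (t :* μ)) := t :* (i :* κ :- i) :* μ :* ν) refl (fromℕ 2) i κ ν μ ⟩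
    fromℕ 2 * (i * κ - i) * μ * ν                    ≡⟨ cong (λ t → fromℕ 2 * (t - i) * μ * ν) (1/n*n≡1 k) ⟩
    fromℕ 2 * (1ℚ - i) * μ * ν                       ∎
    where
    open ≡-Reasoning
    open +-*-Solver
    i = + 1 / k
    κ = fromℕ k
    s = fromℕ S
    μ = fromℕ m
    ν = fromℕ n
    eqℚ : κ * s + ν * (fromℕ 2 * μ) ≡ κ * ν * (fromℕ 2 * μ)
    eqℚ = begin
      κ * s + ν * (fromℕ 2 * μ)                        ≡⟨ cong₂ _+_ (fromℕ-* k S) (trans (fromℕ-* n (2 ℕ.* m)) (cong (ν *_) (fromℕ-* 2 m))) ⟨
      fromℕ (k ℕ.* S) + fromℕ (n ℕ.* (2 ℕ.* m))        ≡⟨ fromℕ-+ (k ℕ.* S) (n ℕ.* (2 ℕ.* m)) ⟨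
      fromℕ (k ℕ.* S ℕ.+ n ℕ.* (2 ℕ.* m))              ≡⟨ cong fromℕ eq ⟩
      fromℕ (k ℕ.* n ℕ.* (2 ℕ.* m))                    ≡⟨ fromℕ-* (k ℕ.* n) (2 ℕ.* m) ⟩
      fromℕ (k ℕ.* n) * fromℕ (2 ℕ.* m)                ≡⟨ cong₂ _*_ (fromℕ-* k n) (fromℕ-* 2 m) ⟩
      κ * ν * (fromℕ 2 * μ)                            ∎

  -- Divided by k (k + e), the coefficient is 1 - 1/k + 1/(k + e), and 1/(k + e) ≤ 1/e ≤ ε.
  scaled⇒≤ : ∀ j ε S n m → 0ℚ < ε → let k = 2 ℕ.+ j ; e = ↧ₙ ε in
             k ℕ.* (k ℕ.+ e) ℕ.* S ℕ.≤ (k ℕ.* k ℕ.+ suc j ℕ.* e) ℕ.* n ℕ.* (2 ℕ.* m) →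
             fromℕ S ≤ fromℕ 2 * (1ℚ - + 1 / k + ε) * fromℕ m * fromℕ n
  scaled⇒≤ j ε S n m 0<ε bound = *-cancelˡ-≤-pos (κ * η) {{κη>0}} (begin
    κ * η * s                                       ≡⟨ cong (λ t → t * s) (fromℕ-* k q) ⟨
    fromℕ (k ℕ.* q) * s                             ≡⟨ fromℕ-* (k ℕ.* q) S ⟨
    fromℕ (k ℕ.* q ℕ.* S)                           ≤⟨ fromℕ-mono-≤ bound ⟩
    fromℕ (a ℕ.* n ℕ.* (2 ℕ.* m))
                                                    ≡⟨ trans (fromℕ-* (a ℕ.* n) (2 ℕ.* m)) (cong₂ _*_ (fromℕ-* a n) (fromℕ-* 2 m)) ⟩
    c * ν * (fromℕ 2 * μ)                           ≡⟨ cong (λ t → t * ν * (fromℕ 2 * μ)) c≡ ⟩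
    (κ * η - η + κ) * ν * (fromℕ 2 * μ)             ≡⟨ regroup (κ * η - η + κ) ⟩
    (κ * η - η + κ) * w                             ≤⟨ *-monoʳ-≤-nonNeg w {{w≥0}} (+-monoʳ-≤ (κ * η - η) κ≤) ⟩
    -- A factor 1 is inserted and rewritten as `i * κ`, so that κ η can be pulled out by a ring
    -- identity.
    (κ * η - η + κ * (ε * η)) * w                   ≡⟨ cong (λ t → (κ * η - t + κ * (ε * η)) * w) (*-identityʳ η) ⟨
    (κ * η - η * 1ℚ + κ * (ε * η)) * w              ≡⟨ cong (λ t → (κ * η - η * t + κ * (ε * η)) * w) (1/n*n≡1 k) ⟨
    (κ * η - η * (i * κ) + κ * (ε * η)) * w         ≡⟨ factor ⟩
    κ * η * (fromℕ 2 * (1ℚ - i + ε) * μ * ν)        ∎)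
    where
    open ≤-Reasoning
    k = 2 ℕ.+ j
    e = ↧ₙ ε
    q = k ℕ.+ e
    a = k ℕ.* k ℕ.+ suc j ℕ.* e
    i = + 1 / k
    κ = fromℕ k
    η = fromℕ q
    s = fromℕ S
    μ = fromℕ m
    ν = fromℕ n
    c = fromℕ a
    w = fromℕ 2 * μ * ν

    w≥0 : NonNegative w
    w≥0 = subst NonNegative (trans (fromℕ-* (2 ℕ.* m) n) (cong (_* ν) (fromℕ-* 2 m))) (fromℕ-nonNeg (2 ℕ.* m ℕ.* n))

    κη>0 : Positive (κ * η)
    κη>0 = subst Positive (fromℕ-* k q) (fromℕ-pos (k ℕ.* q))

    1≤εη : 1ℚ ≤ ε * η
    1≤εη = ≤-trans (denominator-clears ε 0<ε)
      (*-monoˡ-≤-nonNeg ε {{pos⇒nonNeg ε {{positive 0<ε}}}} (fromℕ-mono-≤ (ℕₚ.m≤n+m e k)))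

    κ≤ : κ ≤ κ * (ε * η)
    κ≤ = ≤-trans (≤-reflexive (sym (*-identityʳ κ))) (*-monoˡ-≤-nonNeg κ {{fromℕ-nonNeg k}} 1≤εη)

    -- The coefficient is k q - q + k; adding `q` to both sides keeps the identity inside ℕ.
    a+q : a ℕ.+ q ≡ k ℕ.* q ℕ.+ k
    a+q = identity j e
      where
      open import Data.Nat.Tactic.RingSolver using (solve-∀)
      identity : ∀ j e → let k = 2 ℕ.+ j in
        (k ℕ.* k ℕ.+ (1 ℕ.+ j) ℕ.* e) ℕ.+ (k ℕ.+ e) ≡ k ℕ.* (k ℕ.+ e) ℕ.+ k
      identity = solve-∀

    c≡ : c ≡ κ * η - η + κ
    c≡ = begin-equality
      c                          ≡⟨ solve 2 (λ c η → c := c :+ η :- η) refl c η ⟩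
      c + η - η                  ≡⟨ cong (_- η) (fromℕ-+ a q) ⟨
      fromℕ (a ℕ.+ q) - η        ≡⟨ cong (λ t → fromℕ t - η) a+q ⟩
      fromℕ (k ℕ.* q ℕ.+ k) - η  ≡⟨ cong (_- η) (trans (fromℕ-+ (k ℕ.* q) k) (cong (_+ κ) (fromℕ-* k q))) ⟩
      κ * η + κ - η              ≡⟨ solve 3 (λ x κ η → x :+ κ :- η := x :- η :+ κ) refl (κ * η) κ η ⟩
      κ * η - η + κ              ∎
      where open +-*-Solver

    regroup : ∀ x → x * ν * (fromℕ 2 * μ) ≡ x * w
    regroup x = solve 4 (λ x ν t μ → x :* ν :* (t :* μ) := x :* (t :* μ :* ν)) refl x ν (fromℕ 2) μ
      where open +-*-Solver

    factor : (κ * η - η * (i * κ) + κ * (ε * η)) * w ≡ κ * η * (fromℕ 2 * (1ℚ - i + ε) * μ * ν)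
    factor = solve 7 (λ κ η i ε t μ ν →
      (κ :* η :- η :* (i :* κ) :+ κ :* (ε :* η)) :* (t :* μ :* ν)
        := κ :* η :* (t :* (con 1ℚ :- i :+ ε) :* μ :* ν)) refl κ η i ε (fromℕ 2) μ ν
      where open +-*-Solver

open import Data.Integer using (+_)
open import Data.Nat using (ℕ; suc; zero; NonZero)
open import Data.Nat.Divisibility using (_∣_)
open import Data.Product using (_×_; _,_; ∃-syntax; map₂; proj₁)
open import Data.Rational using (ℚ; 0ℚ; 1ℚ; ↧ₙ_; _/_; _+_; _-_; _*_; _≤_; _<_)
open import Relation.Binary.PropositionalEquality using (_≡_; refl)

theorem2p14 : (k : ℕ) .{{_ : NonZero k}} → 2 Data.Nat.≤ k →
    {f : ℕ} (F : Graph f) → HasChromaticNumber F (Data.Nat.suc k) →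
    ((ε : ℚ) → 0ℚ < ε →
    ∃[ n₀ ] ((n : ℕ) → n₀ Data.Nat.≤ n → (G : Graph n) → F -Free G →
    fromℕ (degreeSquareSum G)
    ≤ fromℕ 2 * (1ℚ - + 1 / k + ε) * fromℕ (edgeCount G) * fromℕ n))
    × (k ≡ 2 → (n : ℕ) (G : Graph n) → IsCompleteBipartite G →
    fromℕ (degreeSquareSum G)
    ≡ fromℕ 2 * (1ℚ - + 1 / k) * fromℕ (edgeCount G) * fromℕ n)
    × (3 Data.Nat.≤ k → (n : ℕ) → k ∣ n → (G : Graph n) → IsTurán G k →
    fromℕ (degreeSquareSum G)
    ≡ fromℕ 2 * (1ℚ - + 1 / k) * fromℕ (edgeCount G) * fromℕ n)
theorem2p14 k@(suc (suc j)) _ F χ =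
    (λ ε 0<ε → map₂
      (λ bound n n₀≤n G free → scaled⇒≤ j ε (degreeSquareSum G) n (edgeCount G) 0<ε (bound n n₀≤n G free))
      (free⇒degreeSquareSum-bound j (↧ₙ ε) F (proj₁ χ)))
  , (λ { refl n G bipartite → scaled⇒≡ 2 (degreeSquareSum G) n (edgeCount G) (bipartite-degreeSquareSum G bipartite) })
  , (λ _ n k∣n G turán → scaled⇒≡ k (degreeSquareSum G) n (edgeCount G) (turán-degreeSquareSum G k∣n turán))
theorem2p14 (suc zero) (Data.Nat.s≤s ()) F χ
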